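{- Let $(E,\mathcal F,\mathcal L)$ be an oriented interval greedoid and $X\in\mathcal F$. Then $(\xi(X),\mathcal F|_{\xi(X)},\mathcal L|_{\xi(X)})$ is an oriented interval greedoid, where $\xi(X)=\xi([X])$ and $\mathcal L|_{\xi(X)}=\{\mathrm{res}_{\xi(X)}(\alpha):\alpha\in\mathcal L\}$.
   Context: Interval greedoid: finite $E$, nonempty family $\mathcal F$ with (IG1) each nonempty $X\in\mathcal F$ has $x$ with $X\setminus\{x\}\in\mathcal F$; (IG2) if $|X|>|Y|$ there is $x\in X\setminus Y$ with $Y\cup\{x\}\in\mathcal F$; (IG3) if $X\subseteq Y\subseteq Z$ in $\mathcal F$, $e\notin Z$, $X\cup\{e\},Z\cup\{e\}\in\mathcal F$, then $Y\cup\{e\}\in\mathcal F$. $\Gamma(X)=\{x\in E\setminus X:X\cup\{x\}\in\mathcal F\}$; $X\sim Y$ iff $\Gamma(X)=\Gamma(Y)$; classes $[X]$ are flats; $\Phi$ the set of flats ordered by $[X]\le[Y]$ iff there is $Z\subseteq E\setminus Y$ with $Y\cup Z\in\mathcal F$ and $Y\cup Z\sim X$ (a lattice). For a flat $A=[X]$: $\Gamma(A)=\Gamma(X)$, $\xi(A)=\bigcup_{X'\sim X}X'$; $\mu(S)=[X]$ for $X$ inclusion-maximal feasible in $S$; join $A\vee B=\mu(\xi(A)\cap\xi(B))$. A covector is $\alpha:E\to\{0,+,-,1\}$ such that for some flat $A=\mathrm{supp}(\alpha)$, $\alpha\in\{+,-\}$ on $\Gamma(A)$, $0$ on $\xi(A)$,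 $1$ elsewhere. Symbols ordered $0<+<1$, $0<-<1$. Product: with $C=\mathrm{supp}\,\alpha\vee\mathrm{supp}\,\beta$, $(\alpha\circ\beta)(e)=\beta(e)$ if $e\in\Gamma(C)\cup\xi(C)$ and $\beta(e)>\alpha(e)$; $\alpha(e)$ if $e\in\Gamma(C)\cup\xi(C)$ otherwise; $1$ otherwise. $-\alpha$ swaps $+,-$; $S(\alpha,\beta)=\{e:\alpha(e)=-\beta(e)\in\{+,-\}\}$. Oriented interval greedoid: $(E,\mathcal F,\mathcal L)$, $\mathcal L$ a set of covectors with (OG1) $\mathrm{supp}:\mathcal L\to\Phi$ surjective; (OG2) $-\mathcal L=\mathcal L$; (OG3) closed under $\circ$; (OG4) if $\alpha,\beta\in\mathcal L$, $x\in S(\alpha,\beta)$, $(\alpha\circ\beta)(x)\ne1$, some $\gamma\in\mathcal L$ has $\gamma(x)=0$ and $\gamma(y)=(\alpha\circ\beta)(y)=(\beta\circ\alpha)(y)$ for all $y\notin S(\alpha,\beta)$ with $(\alpha\circ\beta)(y)\neq1$. Restriction: for $W\subseteq E$, $\mathcal F|_W=\{X\in\mathcal F:X\subseteq W\}$; $(W,\mathcal F|_W)$ is an interval greedoid with its own $\Gamma|_W,\xi|_W,\mu|_W,\Phi|_W$. For $C\in\Phi$ put $C|_W=\mu|_W(W\cap\xi(C))$. For a covector $\alpha$ with $A=\mathrm{supp}(\alpha)$, $\mathrm{res}_W(\alpha):W\to\{0,+,-,1\}$ is $0$ on $\xi|_W(A|_W)$, equals $\alpha$ on $\Gamma|_W(A|_W)$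 (a subset of $\Gamma(A)$), and is $1$ elsewhere on $W$. -}

module Defs where

open import Data.Nat using (ℕ; _>_)
open import Data.Fin using (Fin)
open import Data.Fin.Subset
  using (Subset; _∈_; _∉_; _⊆_; _∪_; ⁅_⁆; _-_; ∣_∣; Nonempty)
open import Data.Vec using (Vec; lookup; map)
open import Data.Product using (Σ; ∃; ∃-syntax; _×_; _,_)
open import Data.Sum using (_⊎_)
open import Data.Bool using (if_then_else_)
open import Relation.Nullary using (¬_; Dec; yes; no)
open import Relation.Nullary.Decidable using (⌊_⌋)
open import Relation.Binary.PropositionalEquality using (_≡_; _≢_)
open import Function.Bundles using (_⇔_)

data Sign : Set where
  s0 s+ s- s1 : Sign

data _<ˢ_ : Sign → Sign → Set where
  0<+ : s0 <ˢ s+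
  0<- : s0 <ˢ s-
  0<1 : s0 <ˢ s1
  +<1 : s+ <ˢ s1
  -<1 : s- <ˢ s1

_<ˢ?_ : (a b : Sign) → Dec (a <ˢ b)
s0 <ˢ? s0 = no λ ()
s0 <ˢ? s+ = yes 0<+
s0 <ˢ? s- = yes 0<-
s0 <ˢ? s1 = yes 0<1
s+ <ˢ? s0 = no λ ()
s+ <ˢ? s+ = no λ ()
s+ <ˢ? s- = no λ ()
s+ <ˢ? s1 = yes +<1
s- <ˢ? s0 = no λ ()
s- <ˢ? s+ = no λ ()
s- <ˢ? s- = no λ ()
s- <ˢ? s1 = yes -<1
s1 <ˢ? _  = no λ ()

negˢ : Sign → Sign
negˢ s+ = s-
negˢ s- = s+
negˢ a  = a

combˢ : Sign → Sign → Sign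
combˢ a b = if ⌊ a <ˢ? b ⌋ then b else a

SVec : ℕ → Set
SVec n = Vec Sign n

negV : ∀ {n} → SVec n → SVec n
negV = map negˢ

InSep : ∀ {n} → SVec n → SVec n → Fin n → Set
InSep α β x = (lookup α x ≡ s+ × lookup β x ≡ s-) ⊎ (lookup α x ≡ s- × lookup β x ≡ s+)

Family : ℕ → Set₁
Family n = Subset n → Set

record IsIntervalGreedoid {n} (G : Subset n) (F : Family n) : Set where
  field
    ground   : ∀ X → F X → X ⊆ G
    nonempty : ∃[ X ] F X
    IG1 : ∀ X → F X → Nonempty X → ∃[ x ] (x ∈ X × F (X - x))
    IG2 : ∀ X Y → F X → F Y → ∣ X ∣ > ∣ Y ∣ →
          ∃[ x ] (x ∈ X × x ∉ Y × F (Y ∪ ⁅ x ⁆))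
    IG3 : ∀ X Y Z e → F X → F Y → F Z → X ⊆ Y → Y ⊆ Z → e ∉ Z →
          F (X ∪ ⁅ e ⁆) → F (Z ∪ ⁅ e ⁆) → F (Y ∪ ⁅ e ⁆)

module Greedoid {n} (G : Subset n) (F : Family n) where

  Γ : Subset n → Fin n → Set
  Γ X e = e ∈ G × e ∉ X × F (X ∪ ⁅ e ⁆)

  _∼_ : Subset n → Subset n → Set
  X ∼ Y = ∀ e → Γ X e ⇔ Γ Y e

  ξ : Subset n → Fin n → Set
  ξ X e = ∃[ Y ] (F Y × Y ∼ X × e ∈ Y)

  -- Z is an inclusion-maximal feasible set contained in S;
  -- then μ(S) = [Z]
  IsMaxFeasIn : (Fin n → Set) → Subset n → Set
  IsMaxFeasIn S Z =
    F Z × (∀ e → e ∈ Z → S e) ×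
    (∀ Z' → F Z' → (∀ e → e ∈ Z' → S e) → Z ⊆ Z' → Z' ⊆ Z)

  -- [Z] = [X] ∨ [Y] = μ(ξ(X) ∩ ξ(Y))
  IsJoin : Subset n → Subset n → Subset n → Set
  IsJoin X Y Z = IsMaxFeasIn (λ e → ξ X e × ξ Y e) Z

  -- α is a covector with supp(α) = [X]  (X feasible):
  -- α ∈ {+,-} on Γ(X), 0 on ξ(X), 1 elsewhere
  IsCovectorAt : Subset n → SVec n → Set
  IsCovectorAt X α = F X × (∀ e →
      (Γ X e → lookup α e ≡ s+ ⊎ lookup α e ≡ s-) ×
      (ξ X e → lookup α e ≡ s0) ×
      (¬ Γ X e → ¬ ξ X e → lookup α e ≡ s1))

  IsCovector : SVec n → Set
  IsCovector α = ∃[ X ] IsCovectorAt X α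

  -- γ = α ∘ β, where Z is a feasible representative of
  -- C = supp α ∨ supp β
  IsProductAt : Subset n → SVec n → SVec n → SVec n → Set
  IsProductAt Z α β γ = ∀ e →
      ((Γ Z e ⊎ ξ Z e) → lookup γ e ≡ combˢ (lookup α e) (lookup β e)) ×
      (¬ (Γ Z e ⊎ ξ Z e) → lookup γ e ≡ s1)

  record IsOIGAxioms (L : SVec n → Set) : Set where
    field
      covectors : ∀ α → L α → IsCovector α
      OG1 : ∀ X → F X → ∃[ α ] (L α × IsCovectorAt X α)
      OG2 : ∀ α → L α → L (negV α)
      OG3 : ∀ α β X Y Z γ → L α → L β →
            IsCovectorAt X α → IsCovectorAt Y β → IsJoin X Y Z →
            IsProductAt Z α β γ → L γ
      OG4 : ∀ α β X Y Z γ γ' x → L α → L β →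
            IsCovectorAt X α → IsCovectorAt Y β → IsJoin X Y Z →
            IsProductAt Z α β γ → IsProductAt Z β α γ' →
            InSep α β x → lookup γ x ≢ s1 →
            ∃[ δ ] (L δ × lookup δ x ≡ s0 ×
              (∀ y → ¬ InSep α β y → lookup γ y ≢ s1 →
                 lookup δ y ≡ lookup γ y × lookup δ y ≡ lookup γ' y))

record IsOrientedIntervalGreedoid {n} (G : Subset n) (F : Family n)
         (L : SVec n → Set) : Set where
  field
    isIntervalGreedoid : IsIntervalGreedoid G F
    axioms : Greedoid.IsOIGAxioms G F L

restrictF : ∀ {n} → Subset n → Family n → Family n
restrictF W F Y = F Y × Y ⊆ W

-- δ = res_W(α) for the greedoid (G,F):
-- with supp α = [Y] and A|_W = μ|_W(W ∩ ξ(A)) = [Z],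
-- δ is 0 on ξ|_W(Z), equals α on Γ|_W(Z), and 1 elsewhere
-- (in particular 1 outside W).
IsRes : ∀ {n} (G : Subset n) (F : Family n) (W : Subset n) →
        SVec n → SVec n → Set
IsRes {n} G F W α δ =
  ∃[ Y ] ∃[ Z ] (Greedoid.IsCovectorAt G F Y α ×
    Greedoid.IsMaxFeasIn W (restrictF W F)
      (λ e → e ∈ W × Greedoid.ξ G F Y e) Z ×
    (∀ e →
      (Greedoid.ξ W (restrictF W F) Z e → lookup δ e ≡ s0) ×
      (Greedoid.Γ W (restrictF W F) Z e → lookup δ e ≡ lookup α e) ×
      (¬ Greedoid.ξ W (restrictF W F) Z e →
       ¬ Greedoid.Γ W (restrictF W F) Z e → lookup δ e ≡ s1)))

restrictL : ∀ {n} (G : Subset n) (F : Family n) (L : SVec n → Set) →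
            Subset n → SVec n → Set
restrictL G F L W δ = ∃[ α ] (L α × IsRes G F W α δ)

{-# OPTIONS --safe #-}
module Submission where

-- Let W = ξ(X) and let β₀ ∈ L have support [X], so that β₀ vanishes on W and is
-- nonzero off W.  Composing with β₀ on the right shows that L|W consists of the
-- restrictions to W of those σ ∈ L whose support is [Z] for a feasible Z ⊆ W;
-- only elimination is then not immediate, since the support [H] of a covector η
-- obtained from (OG4) in E need not have a representative inside W.
-- Let α, β ∈ L have support [A] with A ⊆ W.  Composing with β₀ on the left makes
-- α and β agree off W.  Hence η = ±1 on Γ(A) \ W, while η = 0 on H, so some
-- t ∈ H extends A to a feasible A ∪ {t} ⊆ W.  For ζ ∈ L with support [A ∪ {t}],
-- η∘ζ has support [A ∪ {t}] and keeps the nonzero values common to α and β.  Either it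
-- vanishes at x, or x separates η∘ζ and η∘(-ζ), and elimination is repeated
-- with A ∪ {t} in place of A.

open import Defs
open import Data.Bool using (true; false; if_then_else_)
open import Data.Empty using (⊥-elim)
open import Data.Fin using (Fin; zero; suc; _≟_)
open import Data.Fin.Subset
  using (Subset; _∈_; _∉_; _⊆_; _∪_; ⁅_⁆; _-_; ∣_∣)
open import Data.Fin.Subset.Properties
open import Data.Nat using (zero; suc; _+_; _≤_; _<_; z≤n; s≤s; _≤?_)
open import Data.Nat.Properties
  using (≤-refl; ≤-trans; ≤-reflexive; <-≤-trans; ≤-<-trans; <⇒≱; ≰⇒>;
         +-suc; +-identityʳ; m≤n+m; +-monoˡ-≤; ≤-pred)
open import Data.Product using (∃; ∃-syntax; _×_; _,_; proj₁; proj₂; swap)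
open import Data.Sum using (_⊎_; inj₁; inj₂; [_,_]′)
open import Data.Vec using (_∷_; lookup; tabulate)
open import Data.Vec.Properties using (lookup∘tabulate; lookup-map)
open import Function using (_∘_; id)
open import Function.Bundles using (_⇔_; mk⇔; Equivalence)
open import Relation.Nullary using (¬_; Dec; yes; no; contradiction)
open import Relation.Nullary.Decidable
  using (decidable-stable; _⊎-dec_; does; dec-true; dec-false)
open import Relation.Binary.PropositionalEquality
  using (_≡_; _≢_; refl; sym; trans; cong; cong₂; subst)

open Equivalence using (to; from)

-- Adding one element to a finite subset.

infixl 6 _▸_

_▸_ : ∀ {n} → Subset n → Fin n → Subset n
X ▸ e = X ∪ ⁅ e ⁆

module _ {n} {X : Subset n} where

  ⊆▸ : ∀ {e} → X ⊆ X ▸ e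
  ⊆▸ {e} = p⊆p∪q ⁅ e ⁆

  ∈▸ : ∀ {e} → e ∈ X ▸ e
  ∈▸ {e} = q⊆p∪q X ⁅ e ⁆ (x∈⁅x⁆ e)

  ∈▸⁻ : ∀ {e x} → x ∈ X ▸ e → x ∈ X ⊎ x ≡ e
  ∈▸⁻ {e} x∈ with x∈p∪q⁻ X ⁅ e ⁆ x∈
  ... | inj₁ x∈X = inj₁ x∈X
  ... | inj₂ x∈e = inj₂ (x∈⁅y⁆⇒x≡y e x∈e)

  ▸⊆ : ∀ {e} {Y : Subset n} → X ⊆ Y → e ∈ Y → X ▸ e ⊆ Y
  ▸⊆ X⊆Y e∈Y x∈ with ∈▸⁻ x∈
  ... | inj₁ x∈X  = X⊆Y x∈X
  ... | inj₂ refl = e∈Y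

  ∉▸ : ∀ {e x} → x ∉ X → x ≢ e → x ∉ X ▸ e
  ∉▸ x∉X x≢e x∈ = [ x∉X , x≢e ]′ (∈▸⁻ x∈)

  ∣▸∣> : ∀ {e} → e ∉ X → ∣ X ∣ < ∣ X ▸ e ∣
  ∣▸∣> {e} e∉X = p⊂q⇒∣p∣<∣q∣ (⊆▸ , e , ∈▸ , e∉X)

∣▸∣≤ : ∀ {n} (X : Subset n) e → ∣ X ▸ e ∣ ≤ suc ∣ X ∣
∣▸∣≤ (true  ∷ X) zero rewrite ∪-identityʳ X = m≤n+m _ 1
∣▸∣≤ (false ∷ X) zero rewrite ∪-identityʳ X = ≤-refl
∣▸∣≤ (true  ∷ X) (suc e) = s≤s (∣▸∣≤ X e)
∣▸∣≤ (false ∷ X) (suc e) = ∣▸∣≤ X e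

⊆∧∣∣≥⇒⊇ : ∀ {n} {X Y : Subset n} → X ⊆ Y → ∣ Y ∣ ≤ ∣ X ∣ → Y ⊆ X
⊆∧∣∣≥⇒⊇ {X = X} {Y} X⊆Y Y≤X {e} e∈Y with e ∈? X
... | yes e∈X = e∈X
... | no  e∉X = contradiction Y≤X (<⇒≱ (p⊂q⇒∣p∣<∣q∣ (X⊆Y , e , e∈Y , e∉X)))

-- The algebra of signs.

IsPm : Sign → Set
IsPm s = s ≡ s+ ⊎ s ≡ s-

Opposite : Sign → Sign → Set
Opposite r s = (r ≡ s+ × s ≡ s-) ⊎ (r ≡ s- × s ≡ s+)

_≟ˢ_ : (r s : Sign) → Dec (r ≡ s)
s0 ≟ˢ s0 = yes refl
s0 ≟ˢ s+ = no λ ()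
s0 ≟ˢ s- = no λ ()
s0 ≟ˢ s1 = no λ ()
s+ ≟ˢ s0 = no λ ()
s+ ≟ˢ s+ = yes refl
s+ ≟ˢ s- = no λ ()
s+ ≟ˢ s1 = no λ ()
s- ≟ˢ s0 = no λ ()
s- ≟ˢ s+ = no λ ()
s- ≟ˢ s- = yes refl
s- ≟ˢ s1 = no λ ()
s1 ≟ˢ s0 = no λ ()
s1 ≟ˢ s+ = no λ ()
s1 ≟ˢ s- = no λ ()
s1 ≟ˢ s1 = yes refl

isPm? : ∀ s → Dec (IsPm s)
isPm? s = (s ≟ˢ s+) ⊎-dec (s ≟ˢ s-)

pm≢0 : ∀ {s} → IsPm s → s ≢ s0
pm≢0 (inj₁ refl) ()
pm≢0 (inj₂ refl) ()

pm≢1 : ∀ {s} → IsPm s → s ≢ s1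
pm≢1 (inj₁ refl) ()
pm≢1 (inj₂ refl) ()

pm-neg : ∀ {s} → IsPm s → IsPm (negˢ s)
pm-neg (inj₁ refl) = inj₂ refl
pm-neg (inj₂ refl) = inj₁ refl

pm-≡ : ∀ {r s} → IsPm r → IsPm s → ¬ Opposite r s → r ≡ s
pm-≡ (inj₁ refl) (inj₁ refl) _    = refl
pm-≡ (inj₁ refl) (inj₂ refl) ¬opp = contradiction (inj₁ (refl , refl)) ¬opp
pm-≡ (inj₂ refl) (inj₁ refl) ¬opp = contradiction (inj₂ (refl , refl)) ¬opp
pm-≡ (inj₂ refl) (inj₂ refl) _    = refl

opp-pm : ∀ {r s} → Opposite r s → IsPm r
opp-pm (inj₁ (refl , _)) = inj₁ refl
opp-pm (inj₂ (refl , _)) = inj₂ refl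

opp-≢ : ∀ {r s} → Opposite r s → r ≢ s
opp-≢ (inj₁ (refl , refl)) ()
opp-≢ (inj₂ (refl , refl)) ()

opp-resp : ∀ {r r' s s'} → r ≡ r' → s ≡ s' → Opposite r s → Opposite r' s'
opp-resp refl refl opp = opp

opp-neg : ∀ {s} → s ≢ s0 → s ≢ s1 → Opposite s (negˢ s)
opp-neg {s0} s≢0 _   = contradiction refl s≢0
opp-neg {s+} _   _   = inj₁ (refl , refl)
opp-neg { s- } _   _   = inj₂ (refl , refl)
opp-neg {s1} _   s≢1 = contradiction refl s≢1

opp-comb : ∀ {r s} → Opposite r s → Opposite (combˢ r s) (combˢ s r)
opp-comb (inj₁ (refl , refl)) = inj₁ (refl , refl)
opp-comb (inj₂ (refl , refl)) = inj₂ (refl , refl)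

comb-0ˡ : ∀ s → combˢ s0 s ≡ s
comb-0ˡ s0 = refl
comb-0ˡ s+ = refl
comb-0ˡ s- = refl
comb-0ˡ s1 = refl

comb-≢0ˡ : ∀ {r s} → r ≢ s0 → s ≢ s1 → combˢ r s ≡ r
comb-≢0ˡ {s0} r≢0 _ = contradiction refl r≢0
comb-≢0ˡ {s+} {s0} _ _ = refl
comb-≢0ˡ {s+} {s+} _ _ = refl
comb-≢0ˡ {s+} { s- } _ _ = refl
comb-≢0ˡ { s- } {s0} _ _ = refl
comb-≢0ˡ { s- } {s+} _ _ = refl
comb-≢0ˡ { s- } { s- } _ _ = refl
comb-≢0ˡ {s1} _ _ = refl
comb-≢0ˡ {_}  {s1} _ s≢1 = contradiction refl s≢1

comb-idem : ∀ s → combˢ s s ≡ s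
comb-idem s0 = refl
comb-idem s+ = refl
comb-idem s- = refl
comb-idem s1 = refl

comb-0ʳ : ∀ s → combˢ s s0 ≡ s
comb-0ʳ s0 = refl
comb-0ʳ s+ = refl
comb-0ʳ s- = refl
comb-0ʳ s1 = refl

comb-pm : ∀ {r s} → IsPm r → IsPm s ⊎ s ≡ s0 → IsPm (combˢ r s)
comb-pm {r} {s} pm s≢1 = subst IsPm (sym (comb-≢0ˡ (pm≢0 pm) (neq s≢1))) pm
  where
  neq : IsPm s ⊎ s ≡ s0 → s ≢ s1
  neq (inj₁ pm)   = pm≢1 pm
  neq (inj₂ refl) = λ ()

comb-comm : ∀ r s → ¬ Opposite r s → combˢ r s ≡ combˢ s r
comb-comm s0 s = λ _ → trans (comb-0ˡ s) (sym (comb-0ʳ s))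
comb-comm r s0 = λ _ → trans (comb-0ʳ r) (sym (comb-0ˡ r))
comb-comm s+ s+ = λ _ → refl
comb-comm s+ s- = λ ¬opp → contradiction (inj₁ (refl , refl)) ¬opp
comb-comm s+ s1 = λ _ → refl
comb-comm s- s+ = λ ¬opp → contradiction (inj₂ (refl , refl)) ¬opp
comb-comm s- s- = λ _ → refl
comb-comm s- s1 = λ _ → refl
comb-comm s1 s+ = λ _ → refl
comb-comm s1 s- = λ _ → refl
comb-comm s1 s1 = λ _ → refl

-- Flats of an interval greedoid: comparison, exchange and similarity.

module IntervalGreedoid {n} {G : Subset n} {F : Family n}
                        (isIG : IsIntervalGreedoid G F) where
  open IsIntervalGreedoid isIG
  open Greedoid G F

  Γ⁺ : ∀ {X e} → e ∉ X → F (X ▸ e) → Γ X e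
  Γ⁺ e∉X FXe = ground _ FXe ∈▸ , e∉X , FXe

  ∼-refl : ∀ {X} → X ∼ X
  ∼-refl e = mk⇔ id id

  ∼-sym : ∀ {X Y} → X ∼ Y → Y ∼ X
  ∼-sym X∼Y e = mk⇔ (from (X∼Y e)) (to (X∼Y e))

  ∼-trans : ∀ {X Y Z} → X ∼ Y → Y ∼ Z → X ∼ Z
  ∼-trans X∼Y Y∼Z e = mk⇔ (to (Y∼Z e) ∘ to (X∼Y e)) (from (X∼Y e) ∘ from (Y∼Z e))

  -- For feasible sets this is [Y] ≤ [X] in Φ (the order is reversed).
  _≼_ : Subset n → Subset n → Set
  X ≼ Y = ∀ {x} → x ∈ X → ¬ Γ Y x

  ⊆⇒≼ : ∀ {X Y} → X ⊆ Y → X ≼ Y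
  ⊆⇒≼ X⊆Y x∈X (_ , x∉Y , _) = x∉Y (X⊆Y x∈X)

  ≼-resp-∼ : ∀ {X Y Z} → Y ∼ Z → X ≼ Y → X ≼ Z
  ≼-resp-∼ Y∼Z X≼Y x∈X ΓZx = X≼Y x∈X (from (Y∼Z _) ΓZx)

  ∼⇒≼ : ∀ {X Y} → X ∼ Y → X ≼ Y
  ∼⇒≼ X∼Y = ≼-resp-∼ X∼Y (⊆⇒≼ id)

  ≼-▸ : ∀ {X Y e} → X ≼ Y → ¬ Γ Y e → (X ▸ e) ≼ Y
  ≼-▸ X≼Y ¬ΓYe x∈ with ∈▸⁻ x∈
  ... | inj₁ x∈X  = X≼Y x∈X
  ... | inj₂ refl = ¬ΓYe

  ≼⇒∣∣≤ : ∀ {X Y} → F X → F Y → X ≼ Y → ∣ X ∣ ≤ ∣ Y ∣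
  ≼⇒∣∣≤ {X} {Y} FX FY X≼Y with ∣ X ∣ ≤? ∣ Y ∣
  ... | yes p = p
  ... | no ¬p with IG2 X Y FX FY (≰⇒> ¬p)
  ...   | x , x∈X , x∉Y , FYx = ⊥-elim (X≼Y x∈X (Γ⁺ x∉Y FYx))

  -- If `y` could be added to `X`, then `X ▸ y` would outnumber `Y`, and (IG2) would add to `Y`
  -- either an element of `X`, against `X ≼ Y`, or `y`, which `Y` already has. In `≼-Γ` the same
  -- exchange is forced to add `e`.
  ≼∧∣∣≥⇒≽ : ∀ {X Y} → F X → F Y → X ≼ Y → ∣ Y ∣ ≤ ∣ X ∣ → Y ≼ X
  ≼∧∣∣≥⇒≽ {X} {Y} FX FY X≼Y Y≤X {y} y∈Y (_ , y∉X , FXy)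
    with IG2 (X ▸ y) Y FXy FY (≤-<-trans Y≤X (∣▸∣> y∉X))
  ... | x , x∈ , x∉Y , FYx with ∈▸⁻ x∈
  ...   | inj₁ x∈X  = X≼Y x∈X (Γ⁺ x∉Y FYx)
  ...   | inj₂ refl = x∉Y y∈Y

  ≼-Γ : ∀ {X Y} → F Y → ∣ Y ∣ ≤ ∣ X ∣ → X ≼ Y → ∀ {e} → Γ X e → Γ Y e
  ≼-Γ {X} {Y} FY Y≤X X≼Y {e} (_ , e∉X , FXe)
    with IG2 (X ▸ e) Y FXe FY (≤-<-trans Y≤X (∣▸∣> e∉X))
  ... | x , x∈ , x∉Y , FYx with ∈▸⁻ x∈
  ...   | inj₁ x∈X  = ⊥-elim (X≼Y x∈X (Γ⁺ x∉Y FYx))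
  ...   | inj₂ refl = Γ⁺ x∉Y FYx

  ≼∧∣∣≥⇒∼ : ∀ {X Y} → F X → F Y → X ≼ Y → ∣ Y ∣ ≤ ∣ X ∣ → X ∼ Y
  ≼∧∣∣≥⇒∼ FX FY X≼Y Y≤X e =
    mk⇔ (≼-Γ FY Y≤X X≼Y) (≼-Γ FX (≼⇒∣∣≤ FX FY X≼Y) (≼∧∣∣≥⇒≽ FX FY X≼Y Y≤X))

  ≼-antisym : ∀ {X Y} → F X → F Y → X ≼ Y → Y ≼ X → X ∼ Y
  ≼-antisym FX FY X≼Y Y≼X = ≼∧∣∣≥⇒∼ FX FY X≼Y (≼⇒∣∣≤ FY FX Y≼X)

  ∼⇒∣∣≤ : ∀ {X Y} → F X → F Y → X ∼ Y → ∣ X ∣ ≤ ∣ Y ∣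
  ∼⇒∣∣≤ FX FY X∼Y = ≼⇒∣∣≤ FX FY (∼⇒≼ X∼Y)

  opaque
    -- Iterated (IG2); `k` bounds the number of exchanges still to be made.
    augment : ∀ k {A B} → F A → F B → ∣ B ∣ ≤ ∣ A ∣ + k →
              ∃[ C ] (F C × A ⊆ C × C ⊆ A ∪ B × ∣ B ∣ ≤ ∣ C ∣)
    augment k {A} {B} FA FB B≤ with ∣ B ∣ ≤? ∣ A ∣
    ... | yes B≤A = A , FA , id , p⊆p∪q B , B≤A
    augment zero {A} {B} FA FB B≤ | no B≰A =
      contradiction (≤-trans B≤ (≤-reflexive (+-identityʳ _))) B≰A
    augment (suc k) {A} {B} FA FB B≤ | no B≰A
      with IG2 B A FB FA (≰⇒> B≰A)
    ... | b , b∈B , b∉A , FAb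
      with augment k FAb FB
             (≤-trans B≤ (≤-trans (≤-reflexive (+-suc _ k)) (+-monoˡ-≤ k (∣▸∣> b∉A))))
    ... | C , FC , Ab⊆C , C⊆ , B≤C =
      C , FC , Ab⊆C ∘ ⊆▸ ,
      (λ c∈C → [ ▸⊆ (p⊆p∪q B) (q⊆p∪q A B b∈B) , q⊆p∪q A B ]′ (x∈p∪q⁻ (A ▸ b) B (C⊆ c∈C))) ,
      B≤C

  -- Suppose Y ∼ Z and t ∈ Γ Z, yet some a ∈ Y lies in Γ (Z ▸ t).  Growing A
  -- through feasible subsets of Y, one keeps a set B ∼ Y with A ⊆ B and
  -- a ∈ Γ (B ▸ t); at A = Y this contradicts a ∉ B.
  private
    module Obstruction {Y a t} (FY : F Y) (a∈Y : a ∈ Y) (a≢t : a ≢ t) (ΓYt : Γ Y t) where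

      Bad : Subset n → Set
      Bad B = F B × B ∼ Y × a ∉ B × F (B ▸ t ▸ a)

      -- `B'` is `A` filled up with elements of `B`, so it lies in `B ▸ y` and has the size of `B`.
      -- Exchange from `B ▸ t ▸ a` into `B' ▸ t` can then only supply `a`.
      grow-step : ∀ {A₀ A y B} → F A₀ → F A → A ≡ A₀ ▸ y → A ⊆ Y → A₀ ⊆ B → Bad B →
                  y ∉ B → ∃[ B' ] (A ⊆ B' × Bad B')
      grow-step {A₀} {_} {y} {B} FA₀ FA refl A⊆Y A₀⊆B (FB , B∼Y , a∉B , FBta) y∉B
        with augment ∣ B ∣ FA FB (m≤n+m _ _)
      ... | B' , FB' , A⊆B' , B'⊆ , B≤B' = B' , A⊆B' , FB' , B'∼Y , a∉B' , FB'ta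
        where
        y∈Y : y ∈ Y
        y∈Y = A⊆Y ∈▸
        ΓBt : Γ B t
        ΓBt = from (B∼Y t) ΓYt
        FBt : F (B ▸ t)
        FBt = proj₂ (proj₂ ΓBt)
        t∉Y : t ∉ Y
        t∉Y = proj₁ (proj₂ ΓYt)
        y≢t : y ≢ t
        y≢t refl = t∉Y y∈Y
        -- (IG3) along `A₀ ⊆ B ⊆ B ▸ t` would make `B ▸ y` feasible, putting `y ∈ Y` into `Γ B`,
        -- hence into `Γ Y`.
        ¬FBty : ¬ F (B ▸ t ▸ y)
        ¬FBty FBty = ⊆⇒≼ {Y} id y∈Y (to (B∼Y y) (Γ⁺ y∉B
          (IG3 A₀ B (B ▸ t) y FA₀ FB FBt A₀⊆B ⊆▸ (∉▸ y∉B y≢t) FA FBty)))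
        a≢y : a ≢ y
        a≢y refl = ¬FBty FBta
        B'⊆By : B' ⊆ B ▸ y
        B'⊆By b∈ = [ ▸⊆ (⊆▸ ∘ A₀⊆B) ∈▸ , ⊆▸ ]′ (x∈p∪q⁻ (A₀ ▸ y) B (B'⊆ b∈))
        a∉B' : a ∉ B'
        a∉B' = ∉▸ a∉B a≢y ∘ B'⊆By
        B'≼Y : B' ≼ Y
        B'≼Y b∈ = ≼-▸ (∼⇒≼ B∼Y) (⊆⇒≼ id y∈Y) (B'⊆By b∈)
        B'∼Y : B' ∼ Y
        B'∼Y = ≼∧∣∣≥⇒∼ FB' FY B'≼Y (≤-trans (∼⇒∣∣≤ FY FB (∼-sym B∼Y)) B≤B')
        B'≤B : ∣ B' ∣ ≤ ∣ B ∣
        B'≤B = ∼⇒∣∣≤ FB' FB (∼-trans B'∼Y (∼-sym B∼Y))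
        ΓB't : Γ B' t
        ΓB't = from (B'∼Y t) ΓYt
        FB't : F (B' ▸ t)
        FB't = proj₂ (proj₂ ΓB't)
        smaller : ∣ B' ▸ t ∣ < ∣ B ▸ t ▸ a ∣
        smaller = ≤-<-trans (∣▸∣≤ B' t) (≤-<-trans (s≤s B'≤B)
          (≤-<-trans (∣▸∣> (proj₁ (proj₂ ΓBt))) (∣▸∣> (∉▸ a∉B a≢t))))
        -- An element b ∈ B other than t, a would force B' ▸ b = B ▸ y.
        ¬back : ∀ {b} → b ∈ B → b ∉ B' ▸ t → ¬ F (B' ▸ t ▸ b)
        ¬back {b} b∈B b∉ F' = ¬FBty (subst F (⊆-antisym
            (▸⊆ (▸⊆ (swap▸ ∘ B'⊆By) (⊆▸ ∈▸)) (⊆▸ (⊆▸ b∈B)))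
            (▸⊆ (▸⊆ (swap▸ ∘ By⊆B'b ∘ ⊆▸) (⊆▸ ∈▸)) (swap▸ (By⊆B'b ∈▸)))) F')
          where
          swap▸ : ∀ {X : Subset n} {e} → X ▸ e ⊆ X ▸ t ▸ e
          swap▸ = ▸⊆ (⊆▸ ∘ ⊆▸) ∈▸
          By⊆B'b : B ▸ y ⊆ B' ▸ b
          By⊆B'b = ⊆∧∣∣≥⇒⊇ (▸⊆ B'⊆By (⊆▸ b∈B))
            (≤-trans (∣▸∣≤ B y) (≤-<-trans B≤B' (∣▸∣> (b∉ ∘ ⊆▸))))
        FB'ta : F (B' ▸ t ▸ a)
        FB'ta with IG2 (B ▸ t ▸ a) (B' ▸ t) FBta FB't smaller
        ... | x , x∈ , x∉ , Fx with ∈▸⁻ x∈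
        ...   | inj₂ refl = Fx
        ...   | inj₁ x∈Bt with ∈▸⁻ x∈Bt
        ...     | inj₂ refl = contradiction ∈▸ x∉
        ...     | inj₁ x∈B  = contradiction Fx (¬back x∈B x∉)

      -- (IG1) peels `A` down to the empty set, where any bad set will do; on the way back
      -- `grow-step` reinserts each removed element that is still missing.
      grow : ∀ k {A} → F A → A ⊆ Y → ∣ A ∣ ≤ k → ∃ Bad → ∃[ B ] (A ⊆ B × Bad B)
      grow k {A} FA A⊆Y A≤k (Z , badZ) with nonempty? A
      ... | no  empty = Z , (λ {x} x∈A → ⊥-elim (empty (x , x∈A))) , badZ
      ... | yes (x , x∈A) with k
      ...   | zero  = contradiction A≤k (<⇒≱ (≤-<-trans z≤n (x∈p⇒∣p-x∣<∣p∣ x∈A)))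
      ...   | suc k' with IG1 A FA (x , x∈A)
      ...     | y , y∈A , FA-y with grow k' FA-y (A⊆Y ∘ p─q⊆p A ⁅ y ⁆)
                                     (≤-pred (<-≤-trans (x∈p⇒∣p-x∣<∣p∣ y∈A) A≤k)) (Z , badZ)
      ...       | B , A-y⊆B , badB with y ∈? B
      ...         | no y∉B  = grow-step FA-y FA A≡ A⊆Y A-y⊆B badB y∉B
        where
        A≡ : A ≡ (A - y) ▸ y
        A≡ = ⊆-antisym split (▸⊆ (p─q⊆p A ⁅ y ⁆) y∈A)
          where
          split : A ⊆ (A - y) ▸ y
          split {z} z∈A with z ≟ y
          ... | yes refl = ∈▸
          ... | no z≢y   = ⊆▸ (x∈p∧x≢y⇒x∈p-y z∈A z≢y)
      ...         | yes y∈B = B , A⊆B , badB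
        where
        A⊆B : A ⊆ B
        A⊆B {z} z∈A with z ≟ y
        ... | yes refl = y∈B
        ... | no z≢y   = A-y⊆B (x∈p∧x≢y⇒x∈p-y z∈A z≢y)

      absurd : ¬ ∃ Bad
      absurd bad with grow ∣ Y ∣ FY id ≤-refl bad
      ... | B , Y⊆B , _ , _ , a∉B , _ = a∉B (Y⊆B a∈Y)

  opaque
    -- The cardinalities match, so one comparison suffices. An element `a` of `Y` violating it would
    -- make `Z` a bad set.
    ∼-▸ : ∀ {Y Z t} → F Y → F Z → Y ∼ Z → Γ Z t → (Y ▸ t) ∼ (Z ▸ t)
    ∼-▸ {Y} {Z} {t} FY FZ Y∼Z ΓZt@(_ , t∉Z , FZt) =
      ≼∧∣∣≥⇒∼ (proj₂ (proj₂ ΓYt)) FZt ≼t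
        (≤-trans (∣▸∣≤ Z t) (≤-<-trans (∼⇒∣∣≤ FZ FY (∼-sym Y∼Z)) (∣▸∣> (proj₁ (proj₂ ΓYt)))))
      where
      ΓYt : Γ Y t
      ΓYt = from (Y∼Z t) ΓZt
      ≼t : (Y ▸ t) ≼ (Z ▸ t)
      ≼t {a} a∈ (_ , a∉Zt , FZta) with ∈▸⁻ a∈
      ... | inj₂ refl = a∉Zt ∈▸
      ... | inj₁ a∈Y  = Obstruction.absurd FY a∈Y (λ { refl → a∉Zt ∈▸ }) ΓYt
                          (Z , FZ , ∼-sym Y∼Z , a∉Zt ∘ ⊆▸ , FZta)

  -- Replaying, from Y, the augmentations that lead from Z to B.
  opaque
    ∼-extend : ∀ k {Y Z B} → F Y → F Z → F B → ∣ B ∣ ≤ ∣ Z ∣ + k → Y ∼ Z → Z ⊆ B →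
               ∃[ B' ] (F B' × Y ⊆ B' × B' ∼ B)
    ∼-extend k {Y} {Z} {B} FY FZ FB B≤ Y∼Z Z⊆B with ∣ B ∣ ≤? ∣ Z ∣
    ... | yes B≤Z = Y , FY , id , subst (Y ∼_) (⊆-antisym Z⊆B (⊆∧∣∣≥⇒⊇ Z⊆B B≤Z)) Y∼Z
    ∼-extend zero FY FZ FB B≤ Y∼Z Z⊆B | no B≰Z =
      contradiction (≤-trans B≤ (≤-reflexive (+-identityʳ _))) B≰Z
    ∼-extend (suc k) {Y} {Z} {B} FY FZ FB B≤ Y∼Z Z⊆B | no B≰Z
      with IG2 B Z FB FZ (≰⇒> B≰Z)
    ... | t , t∈B , t∉Z , FZt
      with ∼-extend k (proj₂ (proj₂ (from (Y∼Z t) (Γ⁺ t∉Z FZt)))) FZt FB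
             (≤-trans B≤ (≤-trans (≤-reflexive (+-suc _ k)) (+-monoˡ-≤ k (∣▸∣> t∉Z))))
             (∼-▸ FY FZ Y∼Z (Γ⁺ t∉Z FZt)) (▸⊆ Z⊆B t∈B)
    ... | B' , FB' , Yt⊆B' , B'∼B = B' , FB' , Yt⊆B' ∘ ⊆▸ , B'∼B

  -- The sets `ξ` and their monotonicity.

  ∈⇒ξ : ∀ {X e} → F X → e ∈ X → ξ X e
  ∈⇒ξ {X} FX e∈X = X , FX , ∼-refl , e∈X

  ξ⇒¬Γ : ∀ {X e} → ξ X e → ¬ Γ X e
  ξ⇒¬Γ (Y , FY , Y∼X , e∈Y) ΓXe = proj₁ (proj₂ (from (Y∼X _) ΓXe)) e∈Y

  ⊆ξ⇒≼ : ∀ {X Y} → (∀ {e} → e ∈ X → ξ Y e) → X ≼ Y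
  ⊆ξ⇒≼ X⊆ξY x∈X = ξ⇒¬Γ (X⊆ξY x∈X)

  ξ-resp-∼ : ∀ {X Y} → X ∼ Y → ∀ {e} → ξ X e → ξ Y e
  ξ-resp-∼ X∼Y (Z , FZ , Z∼X , e∈Z) = Z , FZ , ∼-trans Z∼X X∼Y , e∈Z

  opaque
    -- Filling up `X` from `Y` gives `B ∼ Y`. Any `X' ∼ X` can follow the same augmentations to some
    -- `B' ∼ B`, so `X'` sits inside a representative of `[Y]`.
    ≼⇒ξ⊆ξ : ∀ {X Y} → F X → F Y → X ≼ Y → ∀ {e} → ξ X e → ξ Y e
    ≼⇒ξ⊆ξ {X} {Y} FX FY X≼Y (X' , FX' , X'∼X , e∈X')
      with augment ∣ Y ∣ FX FY (m≤n+m _ _)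
    ... | B , FB , X⊆B , B⊆ , Y≤B
      with ∼-extend ∣ B ∣ FX' FX FB (m≤n+m _ _) X'∼X X⊆B
    ... | B' , FB' , X'⊆B' , B'∼B =
      B' , FB' , ∼-trans B'∼B (≼∧∣∣≥⇒∼ FB FY B≼Y Y≤B) , X'⊆B' e∈X'
      where
      B≼Y : B ≼ Y
      B≼Y b∈ = [ X≼Y , ⊆⇒≼ id ]′ (x∈p∪q⁻ X Y (B⊆ b∈))

  -- With `e` outside `Γ Y`, the larger set `X ▸ e` is still `≼ Y`, so monotonicity of `ξ` applies.
  -- Hence a covector at `Y` cannot be `1` on `Γ X`.
  Γ⊆Γ∪ξ : ∀ {X Y e} → F Y → X ≼ Y → Γ X e → ¬ Γ Y e → ξ Y e
  Γ⊆Γ∪ξ FY X≼Y (_ , _ , FXe) ¬ΓYe =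
    ≼⇒ξ⊆ξ FXe FY (≼-▸ X≼Y ¬ΓYe) (∈⇒ξ FXe ∈▸)

  -- IsCovectorAt and IsProductAt unfold to applications of lookup, from which
  -- sign vectors cannot be inferred; these records keep them inferable.
  record Covector (A : Subset n) (α : SVec n) : Set where
    constructor covector
    field isCovectorAt : IsCovectorAt A α

  record Product (Z : Subset n) (α β γ : SVec n) : Set where
    constructor product
    field isProductAt : IsProductAt Z α β γ

  open Covector public
  open Product public

  -- F is not assumed decidable, so Γ and ξ can be split on only for decidable goals.
  opaque
    by-cases : ∀ A e {P : Set} → Dec P → (Γ A e → P) → (ξ A e → P) →
               (¬ Γ A e → ¬ ξ A e → P) → P
    by-cases A e P? inΓ inξ other =
      decidable-stable P? λ ¬p → ¬p (other (¬p ∘ inΓ) (¬p ∘ inξ))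

  -- Values of covectors, joins and products.

  module _ {A α} (cov : Covector A α) where

    cov-F : F A
    cov-F = proj₁ (isCovectorAt cov)

    cov-Γ : ∀ {e} → Γ A e → IsPm (lookup α e)
    cov-Γ = proj₁ (proj₂ (isCovectorAt cov) _)

    cov-ξ : ∀ {e} → ξ A e → lookup α e ≡ s0
    cov-ξ = proj₁ (proj₂ (proj₂ (isCovectorAt cov) _))

    cov-1 : ∀ {e} → ¬ Γ A e → ¬ ξ A e → lookup α e ≡ s1
    cov-1 = proj₂ (proj₂ (proj₂ (isCovectorAt cov) _))

    s0⇒¬Γ : ∀ {e} → lookup α e ≡ s0 → ¬ Γ A e
    s0⇒¬Γ α≡0 γ = pm≢0 (cov-Γ γ) α≡0

    s0⇒ξ : ∀ {e} {P : Set} → Dec P → lookup α e ≡ s0 → (ξ A e → P) → P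
    s0⇒ξ {e} P? α≡0 f = by-cases A e P? (⊥-elim ∘ s0⇒¬Γ α≡0) f
      (λ ¬γ ¬ξ → contradiction (trans (sym α≡0) (cov-1 ¬γ ¬ξ)) λ ())

    ≢1⇒Γ∪ξ : ∀ {e} {P : Set} → Dec P → lookup α e ≢ s1 → (Γ A e → P) → (ξ A e → P) → P
    ≢1⇒Γ∪ξ {e} P? α≢1 f g = by-cases A e P? f g
      (λ ¬γ ¬ξ → contradiction (cov-1 ¬γ ¬ξ) α≢1)

    Γ∪ξ⇒≢1 : ∀ {e} → Γ A e ⊎ ξ A e → lookup α e ≢ s1
    Γ∪ξ⇒≢1 (inj₁ γ) = pm≢1 (cov-Γ γ)
    Γ∪ξ⇒≢1 (inj₂ x) α≡1 = contradiction (trans (sym (cov-ξ x)) α≡1) λ ()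

    cov-resp-∼ : ∀ {B} → F B → A ∼ B → Covector B α
    cov-resp-∼ FB A∼B = covector (FB , λ e →
      cov-Γ ∘ from (A∼B e) ,
      cov-ξ ∘ ξ-resp-∼ (∼-sym A∼B) ,
      λ ¬γ ¬ξ → cov-1 (¬γ ∘ to (A∼B e)) (¬ξ ∘ ξ-resp-∼ A∼B))

    cov-neg : Covector A (negV α)
    cov-neg = covector (cov-F , λ e →
      (λ γ → subst IsPm (sym (lookup-map e negˢ α)) (pm-neg (cov-Γ γ))) ,
      (λ x → trans (lookup-map e negˢ α) (cong negˢ (cov-ξ x))) ,
      (λ ¬γ ¬ξ → trans (lookup-map e negˢ α) (cong negˢ (cov-1 ¬γ ¬ξ))))

    product-value : ∀ {β β' e} → Product A β β' α → lookup α e ≢ s1 →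
                    lookup α e ≡ combˢ (lookup β e) (lookup β' e)
    product-value {e = e} (product isP) α≢1 = ≢1⇒Γ∪ξ (_ ≟ˢ _) α≢1
      (λ γ → proj₁ (isP e) (inj₁ γ)) (λ x → proj₁ (isP e) (inj₂ x))

  module _ {A α β} (covα : Covector A α) (covβ : Covector A β) where

    same-1 : ∀ {e} → lookup α e ≡ s1 → lookup β e ≡ s1
    same-1 {e} α≡1 = by-cases A e (_ ≟ˢ _)
      (λ γ → contradiction α≡1 (Γ∪ξ⇒≢1 covα (inj₁ γ)))
      (λ x → contradiction α≡1 (Γ∪ξ⇒≢1 covα (inj₂ x)))
      (cov-1 covβ)

    same-0 : ∀ {e} → lookup α e ≡ s0 → lookup β e ≡ s0
    same-0 {e} α≡0 = s0⇒ξ covα (_ ≟ˢ _) α≡0 (cov-ξ covβ)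

    ¬sep⇒≡ : ∀ {e} → ¬ InSep α β e → lookup α e ≡ lookup β e
    ¬sep⇒≡ {e} ¬sep = by-cases A e (_ ≟ˢ _)
      (λ γ → pm-≡ (cov-Γ covα γ) (cov-Γ covβ γ) ¬sep)
      (λ x → trans (cov-ξ covα x) (sym (cov-ξ covβ x)))
      (λ ¬γ ¬ξ → trans (cov-1 covα ¬γ ¬ξ) (sym (cov-1 covβ ¬γ ¬ξ)))

  ≼-maximal : ∀ {A Z} → F A → F Z → Z ≼ A → A ⊆ Z → Z ⊆ A
  ≼-maximal FA FZ Z≼A A⊆Z = ⊆∧∣∣≥⇒⊇ A⊆Z (≼⇒∣∣≤ FZ FA Z≼A)

  -- Here `ξ A` lies in `ξ H`, so the intersection is `ξ A`, where no feasible set is larger than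
  -- `A`.
  ≼⇒join : ∀ {A H} → F A → F H → A ≼ H → IsJoin H A A
  ≼⇒join FA FH A≼H = FA ,
    (λ e e∈A → ≼⇒ξ⊆ξ FA FH A≼H (∈⇒ξ FA e∈A) , ∈⇒ξ FA e∈A) ,
    (λ Z FZ Z⊆ A⊆Z → ≼-maximal FA FZ (⊆ξ⇒≼ (proj₂ ∘ Z⊆ _)) A⊆Z)

  opaque
    -- On `Γ Z` neither factor is `1`, by `Γ⊆Γ∪ξ`, and they are not both `0`, by maximality of `Z`
    -- in `ξ X ∩ ξ Y`; so the product is a proper sign there.
    product-covector : ∀ {X Y Z α β γ} → Covector X α → Covector Y β →
                       IsJoin X Y Z → Product Z α β γ → Covector Z γ
    product-covector {X} {Y} {Z} {α} {β} {γ} covα covβ (FZ , Z⊆ , max) (product isP) =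
      covector (FZ , λ e →
        (λ g → subst IsPm (sym (proj₁ (isP e) (inj₁ g))) (onΓ g)) ,
        (λ x → trans (proj₁ (isP e) (inj₂ x))
                 (cong₂ combˢ (cov-ξ covα (≼⇒ξ⊆ξ FZ FX Z≼X x)) (cov-ξ covβ (≼⇒ξ⊆ξ FZ FY Z≼Y x)))) ,
        (λ ¬g ¬x → proj₂ (isP e) [ ¬g , ¬x ]′))
      where
      FX : F X
      FX = cov-F covα
      FY : F Y
      FY = cov-F covβ
      Z≼X : Z ≼ X
      Z≼X = ⊆ξ⇒≼ (proj₁ ∘ Z⊆ _)
      Z≼Y : Z ≼ Y
      Z≼Y = ⊆ξ⇒≼ (proj₂ ∘ Z⊆ _)
      ¬both : ∀ {e} → Γ Z e → ξ X e → ¬ ξ Y e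
      ¬both {e} (_ , e∉Z , FZe) xX xY = e∉Z (max (Z ▸ e) FZe inside ⊆▸ ∈▸)
        where
        inside : ∀ z → z ∈ Z ▸ e → ξ X z × ξ Y z
        inside z z∈ with ∈▸⁻ z∈
        ... | inj₁ z∈Z  = Z⊆ z z∈Z
        ... | inj₂ refl = xX , xY
      onΓ : ∀ {e} → Γ Z e → IsPm (combˢ (lookup α e) (lookup β e))
      onΓ {e} g = by-cases X e (isPm? _)
        (λ gX → by-cases Y e (isPm? _)
          (λ gY → comb-pm (cov-Γ covα gX) (inj₁ (cov-Γ covβ gY)))
          (λ xY → comb-pm (cov-Γ covα gX) (inj₂ (cov-ξ covβ xY)))
          (λ ¬gY ¬xY → ⊥-elim (¬xY (Γ⊆Γ∪ξ FY Z≼Y g ¬gY))))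
        (λ xX → by-cases Y e (isPm? _)
          (λ gY → subst IsPm (sym (trans (cong (λ s → combˢ s _) (cov-ξ covα xX)) (comb-0ˡ _)))
                    (cov-Γ covβ gY))
          (λ xY → ⊥-elim (¬both g xX xY))
          (λ ¬gY ¬xY → ⊥-elim (¬xY (Γ⊆Γ∪ξ FY Z≼Y g ¬gY))))
        (λ ¬gX ¬xX → ⊥-elim (¬xX (Γ⊆Γ∪ξ FX Z≼X g ¬gX)))

-- Composition and elimination in an oriented interval greedoid.

module OrientedIntervalGreedoid {n} {G : Subset n} {F : Family n} {L : SVec n → Set}
                                (isOIG : IsOrientedIntervalGreedoid G F L) where
  open IsOrientedIntervalGreedoid isOIG
  open IsIntervalGreedoid isIntervalGreedoid
  open Greedoid G F
  open IsOIGAxioms axioms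
  open IntervalGreedoid isIntervalGreedoid

  cover : ∀ {X} → F X → ∃[ α ] (L α × Covector X α)
  cover {X} FX with OG1 X FX
  ... | α , Lα , covα = α , Lα , covector covα

  opaque
    compose : ∀ {X Y Z α β} → L α → L β → Covector X α → Covector Y β → IsJoin X Y Z →
              ∃[ γ ] (L γ × Covector Z γ × Product Z α β γ)
    compose {X} {Y} {Z} {α} {β} Lα Lβ covα covβ join with cover (proj₁ join)
    -- Being outside Γ Z ∪ ξ Z is read off a covector τ at Z, since it is not decidable as such.
    ... | τ , _ , covτ =
      γ , OG3 α β X Y Z γ Lα Lβ (isCovectorAt covα) (isCovectorAt covβ) join (isProductAt isP) ,
      product-covector covα covβ join isP , isP
      where
      mask : Sign → Sign → Sign
      mask s1 s = s1
      mask _  s = s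
      mask-≢1 : ∀ {r s} → r ≢ s1 → mask r s ≡ s
      mask-≢1 {s0} _   = refl
      mask-≢1 {s+} _   = refl
      mask-≢1 { s- } _   = refl
      mask-≢1 {s1} r≢1 = contradiction refl r≢1
      value : Fin n → Sign
      value e = mask (lookup τ e) (combˢ (lookup α e) (lookup β e))
      γ : SVec n
      γ = tabulate value
      isP : Product Z α β γ
      isP = product λ e → (λ gx → trans (lookup∘tabulate value e) (mask-≢1 (Γ∪ξ⇒≢1 covτ gx))) ,
              (λ ¬gx → trans (lookup∘tabulate value e)
                         (cong (λ s → mask s _) (cov-1 covτ (¬gx ∘ inj₁) (¬gx ∘ inj₂))))

  opaque
    -- With equal supports the join is `[A]` itself, and both products keep every unseparated value.
    -- As `η` inherits the zeros of `α` on `A`, `A ≼ H` follows; equal rank would give `A ∼ H`,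
    -- although `η` vanishes at `x` and `α` does not.
    eliminate : ∀ {A α β x} → L α → L β → Covector A α → Covector A β → InSep α β x →
                ∃[ η ] ∃[ H ] (L η × Covector H η × A ≼ H × ∣ A ∣ < ∣ H ∣ × lookup η x ≡ s0 ×
                  (∀ {y} → ¬ InSep α β y → lookup α y ≢ s1 → lookup η y ≡ lookup α y))
    eliminate {A} {α} {β} {x} Lα Lβ covα covβ sep
      with ≼⇒join (cov-F covα) (cov-F covα) (⊆⇒≼ id)
    ... | A∨A with compose Lα Lβ covα covβ A∨A | compose Lβ Lα covβ covα A∨A
    ... | γ , _ , covγ , isP | γ' , _ , _ , isP'
      with OG4 α β A A A γ γ' x Lα Lβ (isCovectorAt covα) (isCovectorAt covβ) A∨A
             (isProductAt isP) (isProductAt isP') sep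
             (pm≢1 (opp-pm sep) ∘ same-1 covγ covα)
    ... | η , Lη , ηx≡0 , keep with covectors η Lη
    ...   | H , covη' = η , H , Lη , covη , A≼H , ≰⇒> H≰A , ηx≡0 , kept
      where
      FA : F A
      FA = cov-F covα
      covη : Covector H η
      covη = covector covη'
      kept : ∀ {y} → ¬ InSep α β y → lookup α y ≢ s1 → lookup η y ≡ lookup α y
      kept {y} ¬sep α≢1 =
        trans (proj₁ (keep y ¬sep (α≢1 ∘ same-1 covγ covα)))
          (trans (product-value covγ isP (α≢1 ∘ same-1 covγ covα))
            (trans (cong (combˢ (lookup α y)) (sym (¬sep⇒≡ covα covβ ¬sep))) (comb-idem (lookup α y))))
      A≼H : A ≼ H
      A≼H {a} a∈A = s0⇒¬Γ covη
          (trans (kept (λ s → pm≢0 (opp-pm s) αa≡0) (Γ∪ξ⇒≢1 covα (inj₂ (∈⇒ξ FA a∈A)))) αa≡0)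
        where
        αa≡0 : lookup α a ≡ s0
        αa≡0 = cov-ξ covα (∈⇒ξ FA a∈A)
      H≰A : ¬ ∣ H ∣ ≤ ∣ A ∣
      H≰A H≤A = pm≢0 (opp-pm sep) (same-0 (cov-resp-∼ covη FA (∼-sym A∼H)) covα ηx≡0)
        where
        A∼H : A ∼ H
        A∼H = ≼∧∣∣≥⇒∼ FA (cov-F covη) A≼H H≤A

  -- Elimination with support inside `W`.

  module Restriction {X} (FX : F X) {W : Subset n} (W⇔ξ : ∀ e → e ∈ W ⇔ ξ X e) where

    ⊆W⇒≼ : ∀ {A} → A ⊆ W → A ≼ X
    ⊆W⇒≼ A⊆W = ⊆ξ⇒≼ (to (W⇔ξ _) ∘ A⊆W)

    β₀-spec : ∃[ α ] (L α × Covector X α)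
    β₀-spec = cover FX

    β₀ : SVec n
    β₀ = proj₁ β₀-spec
    Lβ₀ : L β₀
    Lβ₀ = proj₁ (proj₂ β₀-spec)
    covβ₀ : Covector X β₀
    covβ₀ = proj₂ (proj₂ β₀-spec)

    β₀-on-W : ∀ {e} → e ∈ W → lookup β₀ e ≡ s0
    β₀-on-W e∈W = cov-ξ covβ₀ (to (W⇔ξ _) e∈W)

    β₀-off-W : ∀ {e} → e ∉ W → lookup β₀ e ≢ s0
    β₀-off-W {e} e∉W β₀≡0 = e∉W (s0⇒ξ covβ₀ (e ∈? W) β₀≡0 (from (W⇔ξ e)))

    opaque
      -- `α'` is the product of `β₀` and `α`, again supported by `[A]` because `A ≼ X`. On `W` the
      -- zeros of `β₀` let `α` through; off `W` the nonzero values of `β₀` prevail.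
      precompose : ∀ {A α} → A ⊆ W → L α → Covector A α →
                   ∃[ α' ] (L α' × Covector A α' ×
                     (∀ {y} → y ∈ W → lookup α' y ≡ lookup α y) ×
                     (∀ {y} → y ∉ W → lookup α' y ≢ s1 → lookup α' y ≡ lookup β₀ y))
      precompose {A} {α} A⊆W Lα covα
        with compose Lβ₀ Lα covβ₀ covα (≼⇒join (cov-F covα) FX (⊆W⇒≼ A⊆W))
      ... | α' , Lα' , covα' , isP = α' , Lα' , covα' , on , off
        where
        on : ∀ {y} → y ∈ W → lookup α' y ≡ lookup α y
        on {y} y∈W with lookup α' y ≟ˢ s1
        ... | yes α'≡1 = trans α'≡1 (sym (same-1 covα' covα α'≡1))
        ... | no  α'≢1 = trans (product-value covα' isP α'≢1)
                           (trans (cong (λ s → combˢ s _) (β₀-on-W y∈W)) (comb-0ˡ _))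
        off : ∀ {y} → y ∉ W → lookup α' y ≢ s1 → lookup α' y ≡ lookup β₀ y
        off y∉W α'≢1 = trans (product-value covα' isP α'≢1)
                         (comb-≢0ˡ (β₀-off-W y∉W) (α'≢1 ∘ same-1 covα covα'))

    -- The demand beyond (OG4) is `B ⊆ W`. For covectors with a common support, equality at `y` says
    -- the same as not being separated there.
    Elimination : Fin n → SVec n → SVec n → Set
    Elimination x α β = ∃[ δ ] ∃[ B ] (L δ × Covector B δ × B ⊆ W × lookup δ x ≡ s0 ×
      (∀ {y} → y ∈ W → lookup α y ≡ lookup β y → lookup α y ≢ s1 → lookup δ y ≡ lookup α y))

    opaque
      -- Induction on `k`, a bound for `n` minus the size of `A`; each round adds one element to
      -- `A`.
      eliminate-in-W : ∀ k {A α β x} → n ≤ ∣ A ∣ + k → A ⊆ W → L α → L β →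
                       Covector A α → Covector A β → x ∈ W → InSep α β x →
                       Elimination x α β
      eliminate-in-W k {A} {α} {β} {x} n≤ A⊆W Lα Lβ covα covβ x∈W sep
        with precompose A⊆W Lα covα | precompose A⊆W Lβ covβ
      ... | α' , Lα' , covα' , α'-on , α'-off | β' , Lβ' , covβ' , β'-on , β'-off
        with eliminate {x = x} Lα' Lβ' covα' covβ'
               (opp-resp (sym (α'-on x∈W)) (sym (β'-on x∈W)) sep)
      ... | η , H , Lη , covη , A≼H , A<H , ηx≡0 , keep with IG2 H A (cov-F covη) (cov-F covα) A<H
      ... | t , t∈H , t∉A , FAt with cover FAt
      ...   | ζ , Lζ , covζ = finish
        where
        FA : F A
        FA = cov-F covα
        FH : F H
        FH = cov-F covη
        ηt≡0 : lookup η t ≡ s0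
        ηt≡0 = cov-ξ covη (∈⇒ξ FH t∈H)
        t∈W : t ∈ W
        t∈W with t ∈? W
        ... | yes t∈W = t∈W
        ... | no  t∉W = ⊥-elim (pm≢0 (cov-Γ covα' ΓAt) (trans (sym (keep ¬sep α't≢1)) ηt≡0))
          where
          ΓAt : Γ A t
          ΓAt = Γ⁺ t∉A FAt
          α't≢1 : lookup α' t ≢ s1
          α't≢1 = Γ∪ξ⇒≢1 covα' (inj₁ ΓAt)
          ¬sep : ¬ InSep α' β' t
          ¬sep s = opp-≢ s (trans (α'-off t∉W α't≢1)
                     (sym (β'-off t∉W (Γ∪ξ⇒≢1 covβ' (inj₁ ΓAt)))))
        A≼At : A ≼ (A ▸ t)
        A≼At = ⊆⇒≼ ⊆▸
        At≼H : (A ▸ t) ≼ H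
        At≼H = ≼-▸ A≼H (⊆⇒≼ id t∈H)
        At⊆W : A ▸ t ⊆ W
        At⊆W = ▸⊆ A⊆W t∈W
        H∨At : IsJoin H (A ▸ t) (A ▸ t)
        H∨At = ≼⇒join FAt FH At≼H
        -- Stated for any `ζ`, to cover both `ζ` and its negative. On `Γ A` the common value
        -- survives in `η` as a nonzero sign, so `y` is not in `ξ H` and hence not in `ξ (A ▸ t)`.
        -- It must be in `Γ (A ▸ t)`, where `η` dominates the product.
        kept : ∀ {ζ θ} → Covector (A ▸ t) ζ → Covector (A ▸ t) θ →
               Product (A ▸ t) η ζ θ → ∀ {y} → y ∈ W → lookup α y ≡ lookup β y →
               lookup α y ≢ s1 → lookup θ y ≡ lookup α y
        kept {ζ} {θ} covζ covθ isP {y} y∈W α≡β α≢1 = ≢1⇒Γ∪ξ covα (_ ≟ˢ _) α≢1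
          (λ g → by-cases (A ▸ t) y (_ ≟ˢ _)
            (λ g' → trans (product-value covθ isP (Γ∪ξ⇒≢1 covθ (inj₁ g')))
                      (trans (comb-≢0ˡ (η≢0 g) (Γ∪ξ⇒≢1 covζ (inj₁ g'))) ηy))
            (λ x' → ⊥-elim (η≢0 g (cov-ξ covη (≼⇒ξ⊆ξ FAt FH At≼H x'))))
            (λ ¬g ¬x → ⊥-elim (¬x (Γ⊆Γ∪ξ FAt A≼At g ¬g))))
          (λ x' → trans (cov-ξ covθ (≼⇒ξ⊆ξ FA FAt A≼At x')) (sym (cov-ξ covα x')))
          where
          α'≡β' : lookup α' y ≡ lookup β' y
          α'≡β' = trans (α'-on y∈W) (trans α≡β (sym (β'-on y∈W)))
          ηy : lookup η y ≡ lookup α y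
          ηy = trans (keep (λ s → opp-≢ s α'≡β') (α≢1 ∘ trans (sym (α'-on y∈W)))) (α'-on y∈W)
          η≢0 : Γ A y → lookup η y ≢ s0
          η≢0 g η≡0 = pm≢0 (cov-Γ covα g) (trans (sym ηy) η≡0)
        finish : Elimination x α β
        finish with compose Lη Lζ covη covζ H∨At
                  | compose Lη (OG2 ζ Lζ) covη (cov-neg covζ) H∨At
        ... | θ , Lθ , covθ , isP | θ' , Lθ' , covθ' , isP' with lookup ζ x ≟ˢ s0
        ...   | yes ζx≡0 = θ , A ▸ t , Lθ , covθ , At⊆W , same-0 covζ covθ ζx≡0 ,
                           kept covζ covθ isP
        ...   | no  ζx≢0 = recurse k n≤
          where
          -- `x` is in `Γ A` or `ξ A`, and passing to `A ▸ t` cannot push it out of `Γ` and `ξ`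
          -- altogether.
          ζx≢1 : lookup ζ x ≢ s1
          ζx≢1 ζ≡1 = ≢1⇒Γ∪ξ covα (no id) (pm≢1 (opp-pm sep))
            (λ g → by-cases (A ▸ t) x (no id)
               (λ g' → Γ∪ξ⇒≢1 covζ (inj₁ g') ζ≡1)
               (λ x' → Γ∪ξ⇒≢1 covζ (inj₂ x') ζ≡1)
               (λ ¬g ¬x → ¬x (Γ⊆Γ∪ξ FAt A≼At g ¬g)))
            (λ x' → Γ∪ξ⇒≢1 covζ (inj₂ (≼⇒ξ⊆ξ FA FAt A≼At x')) ζ≡1)
          at-x : ∀ {ζ' θ'} → lookup θ' x ≢ s1 → Covector (A ▸ t) θ' →
                 Product (A ▸ t) η ζ' θ' → lookup θ' x ≡ lookup ζ' x
          at-x θ'≢1 covθ' isP = trans (product-value covθ' isP θ'≢1)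
            (trans (cong (λ s → combˢ s _) ηx≡0) (comb-0ˡ _))
          sep' : InSep θ θ' x
          sep' = opp-resp
            (sym (at-x (ζx≢1 ∘ same-1 covθ covζ) covθ isP))
            (sym (trans (at-x (ζx≢1 ∘ same-1 covθ' covζ) covθ' isP') (lookup-map x negˢ ζ)))
            (opp-neg ζx≢0 ζx≢1)
          recurse : ∀ k → n ≤ ∣ A ∣ + k → Elimination x α β
          -- Here `A` already has `n` elements, which leaves no room for `t`.
          recurse zero n≤ = contradiction (≤-trans (≤-trans (∣p∣≤n (A ▸ t)) n≤)
            (≤-reflexive (+-identityʳ _))) (<⇒≱ (∣▸∣> t∉A))
          recurse (suc k) n≤ with eliminate-in-W k
              (≤-trans n≤ (≤-trans (≤-reflexive (+-suc _ k)) (+-monoˡ-≤ k (∣▸∣> t∉A))))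
              At⊆W Lθ Lθ' covθ covθ' x∈W sep'
          ... | δ , B , Lδ , covδ , B⊆W , δx≡0 , keepδ =
            δ , B , Lδ , covδ , B⊆W , δx≡0 , λ y∈W α≡β α≢1 →
              -- A common value of `α` and `β` passes to both `θ` and `θ'`, so the recursive
              -- elimination preserves it.
              let θ≡α  = kept covζ covθ isP y∈W α≡β α≢1
                  θ'≡α = kept (cov-neg covζ) covθ' isP' y∈W α≡β α≢1
              in trans (keepδ y∈W (trans θ≡α (sym θ'≡α)) (α≢1 ∘ trans (sym θ≡α))) θ≡α

    -- Vectors keep length `n`. The value off `W` is `1` because such elements lie in neither `Γ`
    -- nor `ξ` of the restricted greedoid.
    restrict : SVec n → SVec n
    restrict σ = tabulate λ e → if does (e ∈? W) then lookup σ e else s1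

    -- For supports represented inside `W`, copying entries satisfies `IsRes`; `lift` and `descend`
    -- replace `IsRes` by this simpler relation.
    record RestrictsTo (σ δ : SVec n) : Set where
      constructor restrictsTo
      field
        on  : ∀ {e} → e ∈ W → lookup δ e ≡ lookup σ e
        off : ∀ {e} → e ∉ W → lookup δ e ≡ s1

    restricts : ∀ σ → RestrictsTo σ (restrict σ)
    restricts σ = restrictsTo
      (λ {e} e∈W → trans (lookup∘tabulate _ e)
                     (cong (if_then lookup σ e else s1) (dec-true (e ∈? W) e∈W)))
      (λ {e} e∉W → trans (lookup∘tabulate _ e)
                     (cong (if_then lookup σ e else s1) (dec-false (e ∈? W) e∉W)))

    restricts-∈W : ∀ {σ δ e} → RestrictsTo σ δ → lookup δ e ≢ s1 → e ∈ W
    restricts-∈W {e = e} res δ≢1 = decidable-stable (e ∈? W) (δ≢1 ∘ RestrictsTo.off res)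

    -- The restricted greedoid, its sets `Γ` and `ξ`, and the passage between `L` and its
    -- restriction.

    private
      FW : Family n
      FW = restrictF W F
      LW : SVec n → Set
      LW = restrictL G F L W
      module R = Greedoid W FW

    restriction-isIG : IsIntervalGreedoid W FW
    restriction-isIG = record
      { ground   = λ _ → proj₂
      ; nonempty = X , FX , from (W⇔ξ _) ∘ ∈⇒ξ FX
      ; IG1 = λ A (FA , A⊆W) ne → let x , x∈A , FA-x = IG1 A FA ne in
                x , x∈A , FA-x , A⊆W ∘ p─q⊆p A ⁅ x ⁆
      ; IG2 = λ A B (FA , A⊆W) (FB , B⊆W) A>B → let x , x∈A , x∉B , FBx = IG2 A B FA FB A>B in
                x , x∈A , x∉B , FBx , ▸⊆ B⊆W (A⊆W x∈A)
      ; IG3 = λ A B C e (FA , _) (FB , B⊆W) (FC , _) A⊆B B⊆C e∉C (FAe , Ae⊆W) (FCe , _) →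
                IG3 A B C e FA FB FC A⊆B B⊆C e∉C FAe FCe , ▸⊆ B⊆W (Ae⊆W ∈▸)
      }

    private module RI = IntervalGreedoid restriction-isIG

    module _ {Z} (FZ : F Z) (Z⊆W : Z ⊆ W) where

      Γ⇒ΓW : ∀ {e} → e ∈ W → Γ Z e → R.Γ Z e
      Γ⇒ΓW e∈W (_ , e∉Z , FZe) = e∈W , e∉Z , FZe , ▸⊆ Z⊆W e∈W

      ξ⊆W : ∀ {e} → ξ Z e → e ∈ W
      ξ⊆W = from (W⇔ξ _) ∘ ≼⇒ξ⊆ξ FZ FX (⊆W⇒≼ Z⊆W)

      -- Every `Y ∼ Z` lies in `ξ Z`, hence in `ξ X`, so it survives the restriction to `W`.
      ξ⇒ξW : ∀ {e} → ξ Z e → R.ξ Z e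
      ξ⇒ξW (Y , FY , Y∼Z , e∈Y) = Y , (FY , Y⊆W) , Y∼WZ , e∈Y
        where
        Y⊆W : Y ⊆ W
        Y⊆W y∈Y = ξ⊆W (Y , FY , Y∼Z , y∈Y)
        Y∼WZ : Y R.∼ Z
        Y∼WZ e = mk⇔
          (λ (e∈W , e∉Y , FYe , _) → Γ⇒ΓW e∈W (to (Y∼Z e) (Γ⁺ e∉Y FYe)))
          (λ (e∈W , e∉Z , FZe , _) → let _ , e∉Y , FYe = from (Y∼Z e) (Γ⁺ e∉Z FZe) in
             e∈W , e∉Y , FYe , ▸⊆ Y⊆W e∈W)

    ΓW⇒Γ : ∀ {Z e} → R.Γ Z e → Γ Z e
    ΓW⇒Γ (_ , e∉Z , FZe , _) = Γ⁺ e∉Z FZe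

    ξW⇒⊆W : ∀ {Z e} → R.ξ Z e → e ∈ W
    ξW⇒⊆W (_ , (_ , Y⊆W) , _ , e∈Y) = Y⊆W e∈Y

    -- Similarity in `W` only compares continuations inside `W`. But `Y ≼ Z` and `Z ≼ Y` test only
    -- elements of `Y` and `Z`, all in `W`, and antisymmetry gives similarity in `G`.
    ξW⇒ξ : ∀ {Z e} → F Z → Z ⊆ W → R.ξ Z e → ξ Z e
    ξW⇒ξ {Z} FZ Z⊆W (Y , (FY , Y⊆W) , Y∼Z , e∈Y) = Y , FY , ≼-antisym FY FZ Y≼Z Z≼Y , e∈Y
      where
      Y≼Z : Y ≼ Z
      Y≼Z y∈Y ΓZy = proj₁ (proj₂ (from (Y∼Z _) (Γ⇒ΓW FZ Z⊆W (Y⊆W y∈Y) ΓZy))) y∈Y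
      Z≼Y : Z ≼ Y
      Z≼Y z∈Z ΓYz = proj₁ (proj₂ (to (Y∼Z _) (Γ⇒ΓW FY Y⊆W (Z⊆W z∈Z) ΓYz))) z∈Z

    restriction-covector : ∀ {Z σ δ} → Covector Z σ → Z ⊆ W → RestrictsTo σ δ →
                           RI.Covector Z δ
    restriction-covector {Z} {σ} {δ} covσ Z⊆W (restrictsTo on off) =
      RI.covector ((FZ , Z⊆W) , λ e →
        (λ g → subst IsPm (sym (on (proj₁ g))) (cov-Γ covσ (ΓW⇒Γ g))) ,
        (λ x → trans (on (ξW⇒⊆W x)) (cov-ξ covσ (ξW⇒ξ FZ Z⊆W x))) ,
        outer e)
      where
      FZ : F Z
      FZ = cov-F covσ
      outer : ∀ e → ¬ R.Γ Z e → ¬ R.ξ Z e → lookup δ e ≡ s1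
      outer e ¬g ¬x with e ∈? W
      ... | yes e∈W = trans (on e∈W) (cov-1 covσ (¬g ∘ Γ⇒ΓW FZ Z⊆W e∈W) (¬x ∘ ξ⇒ξW FZ Z⊆W))
      ... | no  e∉W = off e∉W

    -- The lift of res α is α ∘ β₀.
    opaque
      lift : ∀ {δ} → LW δ → ∃[ σ ] ∃[ Z ] (L σ × Covector Z σ × Z ⊆ W × RestrictsTo σ δ)
      lift {δ} (α , Lα , Y , Z , covα' , ((FZ , Z⊆W) , Z⊆ , max) , vals)
        with compose Lα Lβ₀ (covector covα') covβ₀ join
        where
        join : IsJoin Y X Z
        -- As `W` is `ξ X`, maximality in `W ∩ ξ Y` is the defining property of the join of `[Y]`
        -- and `[X]`.
        join = FZ , (λ e e∈Z → let e∈W , ξYe = Z⊆ e e∈Z in ξYe , to (W⇔ξ e) e∈W) ,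
          λ Z' FZ' Z'⊆ → max Z' (FZ' , λ e∈Z' → from (W⇔ξ _) (proj₂ (Z'⊆ _ e∈Z')))
            (λ e e∈Z' → let ξYe , ξXe = Z'⊆ e e∈Z' in from (W⇔ξ e) ξXe , ξYe)
      ... | σ , Lσ , covσ , product isP = σ , Z , Lσ , covσ , Z⊆W , restrictsTo on off
        where
        on : ∀ {e} → e ∈ W → lookup δ e ≡ lookup σ e
        on {e} e∈W = by-cases Z e (_ ≟ˢ _)
          (λ g → trans (proj₁ (proj₂ (vals e)) (Γ⇒ΓW FZ Z⊆W e∈W g))
                   (sym (trans (proj₁ (isP e) (inj₁ g))
                     (trans (cong (combˢ (lookup α e)) (β₀-on-W e∈W)) (comb-0ʳ _)))))
          (λ x → trans (proj₁ (vals e) (ξ⇒ξW FZ Z⊆W x)) (sym (cov-ξ covσ x)))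
          (λ ¬g ¬x → trans (proj₂ (proj₂ (vals e)) (¬x ∘ ξW⇒ξ FZ Z⊆W) (¬g ∘ ΓW⇒Γ))
                       (sym (cov-1 covσ ¬g ¬x)))
        off : ∀ {e} → e ∉ W → lookup δ e ≡ s1
        off {e} e∉W = proj₂ (proj₂ (vals e)) (e∉W ∘ ξW⇒⊆W) (e∉W ∘ proj₁)

    opaque
      -- The representative found by `lift` need not be `A`, but the zeros and signs of `δ`
      -- determine the flat.
      lift-at : ∀ {A δ} → LW δ → RI.Covector A δ →
                ∃[ σ ] (L σ × Covector A σ × RestrictsTo σ δ)
      lift-at {A} Lδ (RI.covector ((FA , A⊆W) , vals)) with lift Lδ
      ... | σ , Z , Lσ , covσ , Z⊆W , res@(restrictsTo on _) =
        σ , Lσ , cov-resp-∼ covσ FA (≼-antisym FZ FA Z≼A A≼Z) , res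
        where
        FZ : F Z
        FZ = cov-F covσ
        A≼Z : A ≼ Z
        A≼Z a∈A = s0⇒¬Γ covσ (trans (sym (on (A⊆W a∈A)))
          (proj₁ (proj₂ (vals _)) (ξ⇒ξW FA A⊆W (∈⇒ξ FA a∈A))))
        Z≼A : Z ≼ A
        Z≼A z∈Z ΓAz = pm≢0 (proj₁ (vals _) (Γ⇒ΓW FA A⊆W (Z⊆W z∈Z) ΓAz))
          (trans (on (Z⊆W z∈Z)) (cov-ξ covσ (∈⇒ξ FZ z∈Z)))

    descend : ∀ {Z σ δ} → L σ → Covector Z σ → Z ⊆ W → RestrictsTo σ δ → LW δ
    descend {Z} {σ} {δ} Lσ covσ Z⊆W res =
      -- `Z` represents both the support of `σ` and its restriction, being maximal in its own `ξ`.
      σ , Lσ , Z , Z , isCovectorAt covσ ,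
      ((FZ , Z⊆W) , (λ e e∈Z → Z⊆W e∈Z , ∈⇒ξ FZ e∈Z) ,
        λ Z' (FZ' , _) Z'⊆ → ≼-maximal FZ FZ' (⊆ξ⇒≼ (proj₂ ∘ Z'⊆ _))) ,
      λ e → proj₁ (proj₂ (vals e)) , (λ g → RestrictsTo.on res (proj₁ g)) ,
            λ ¬x ¬g → proj₂ (proj₂ (vals e)) ¬g ¬x
      where
      FZ : F Z
      FZ = cov-F covσ
      vals = proj₂ (RI.isCovectorAt (restriction-covector covσ Z⊆W res))

    opaque
      -- The sets `ξ` agree in `W` and in `G`, hence so do the joins, and the product of lifts lifts
      -- the product.
      restriction-product : ∀ {A B Z α β γ} → LW α → LW β → RI.Covector A α →
        RI.Covector B β → R.IsJoin A B Z → RI.Product Z α β γ →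
        ∃[ τ ] (L τ × Covector Z τ × Z ⊆ W × RestrictsTo τ γ)
      restriction-product {A} {B} {Z} {α} {β} {γ} Lα Lβ covα covβ
          ((FZ , Z⊆W) , Z⊆ , max) (RI.product isP)
        with lift-at Lα covα | lift-at Lβ covβ
      ... | σ , Lσ , covσ , restrictsTo onσ _ | ρ , Lρ , covρ , restrictsTo onρ _
        with compose Lσ Lρ covσ covρ join
        where
        FA : F A
        FA = cov-F covσ
        FB : F B
        FB = cov-F covρ
        A⊆W : A ⊆ W
        A⊆W = proj₂ (RI.cov-F covα)
        B⊆W : B ⊆ W
        B⊆W = proj₂ (RI.cov-F covβ)
        join : IsJoin A B Z
        join = FZ , (λ e e∈Z → let xA , xB = Z⊆ e e∈Z in ξW⇒ξ FA A⊆W xA , ξW⇒ξ FB B⊆W xB) ,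
          λ Z' FZ' Z'⊆ → max Z' (FZ' , λ e∈Z' → ξ⊆W FA A⊆W (proj₁ (Z'⊆ _ e∈Z')))
            (λ e e∈Z' → let xA , xB = Z'⊆ e e∈Z' in ξ⇒ξW FA A⊆W xA , ξ⇒ξW FB B⊆W xB)
      ... | τ , Lτ , covτ , product isPτ = τ , Lτ , covτ , Z⊆W , restrictsTo on off
        where
        agree : ∀ {e} → e ∈ W → combˢ (lookup α e) (lookup β e) ≡ combˢ (lookup σ e) (lookup ρ e)
        agree e∈W = cong₂ combˢ (onσ e∈W) (onρ e∈W)
        on : ∀ {e} → e ∈ W → lookup γ e ≡ lookup τ e
        on {e} e∈W = by-cases Z e (_ ≟ˢ _)
          (λ g → trans (proj₁ (isP e) (inj₁ (Γ⇒ΓW FZ Z⊆W e∈W g)))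
                   (trans (agree e∈W) (sym (proj₁ (isPτ e) (inj₁ g)))))
          (λ x → trans (proj₁ (isP e) (inj₂ (ξ⇒ξW FZ Z⊆W x)))
                   (trans (agree e∈W) (sym (proj₁ (isPτ e) (inj₂ x)))))
          (λ ¬g ¬x → trans (proj₂ (isP e) [ ¬g ∘ ΓW⇒Γ , ¬x ∘ ξW⇒ξ FZ Z⊆W ]′)
                       (sym (cov-1 covτ ¬g ¬x)))
        off : ∀ {e} → e ∉ W → lookup γ e ≡ s1
        off {e} e∉W = proj₂ (isP e) [ e∉W ∘ proj₁ , e∉W ∘ ξW⇒⊆W ]′

    -- The axioms for the restriction.

    restriction-OG1 : ∀ Z → FW Z → ∃[ δ ] (LW δ × R.IsCovectorAt Z δ)
    restriction-OG1 Z (FZ , Z⊆W) with cover FZ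
    ... | σ , Lσ , covσ = restrict σ , descend Lσ covσ Z⊆W (restricts σ) ,
                          RI.isCovectorAt (restriction-covector covσ Z⊆W (restricts σ))

    restriction-OG2 : ∀ δ → LW δ → LW (negV δ)
    restriction-OG2 δ Lδ with lift {δ} Lδ
    ... | σ , Z , Lσ , covσ , Z⊆W , restrictsTo on off =
      descend {δ = negV δ} (OG2 σ Lσ) (cov-neg covσ) Z⊆W
      (restrictsTo
        (λ {e} e∈W → trans (lookup-map e negˢ δ)
                       (trans (cong negˢ (on e∈W)) (sym (lookup-map e negˢ σ))))
        (λ {e} e∉W → trans (lookup-map e negˢ δ) (cong negˢ (off e∉W))))

    -- `α` and `β` may have different supports, so elimination is applied to lifts of the two
    -- products, which share the support `[Z]`. They are still opposite at `x`, and agree wherever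
    -- `α` and `β` are not separated.
    restriction-OG4 : ∀ {α β A B Z γ γ' x} → LW α → LW β →
      RI.Covector A α → RI.Covector B β → R.IsJoin A B Z →
      RI.Product Z α β γ → RI.Product Z β α γ' → InSep α β x → lookup γ x ≢ s1 →
      ∃[ δ ] (LW δ × lookup δ x ≡ s0 ×
        (∀ y → ¬ InSep α β y → lookup γ y ≢ s1 →
           lookup δ y ≡ lookup γ y × lookup δ y ≡ lookup γ' y))
    restriction-OG4 {α} {β} {A} {B} {Z} {γ} {γ'} {x} Lα Lβ covα covβ
        join@((FZ , _) , Z⊆ , max) isP isP' sep γx≢1
      with restriction-product Lα Lβ covα covβ join isP
         | restriction-product Lβ Lα covβ covα
             (proj₁ join , (λ e → swap ∘ Z⊆ e) , λ Z' FZ' Z'⊆ → max Z' FZ' (λ e → swap ∘ Z'⊆ e)) isP'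
    ... | τ , Lτ , covτ , Z⊆W , res@(restrictsTo on _) | τ' , Lτ' , covτ' , _ , res'@(restrictsTo on' _)
      with eliminate-in-W n (m≤n+m n _) Z⊆W Lτ Lτ' covτ covτ' (restricts-∈W res γx≢1) sepτ
      where
      covγ  = restriction-covector covτ Z⊆W res
      covγ' = restriction-covector covτ' Z⊆W res'
      x∈W = restricts-∈W res γx≢1
      sepτ : InSep τ τ' x
      sepτ = opp-resp (on x∈W) (on' x∈W) (opp-resp
        (sym (RI.product-value covγ isP γx≢1))
        (sym (RI.product-value covγ' isP' (γx≢1 ∘ RI.same-1 covγ' covγ)))
        (opp-comb sep))
    ... | δ , B' , Lδ , covδ , B'⊆W , δx≡0 , keep =
      restrict δ , descend Lδ covδ B'⊆W (restricts δ) ,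
      trans (RestrictsTo.on (restricts δ) (restricts-∈W res γx≢1)) δx≡0 , kept
      where
      covγ  = restriction-covector covτ Z⊆W res
      covγ' = restriction-covector covτ' Z⊆W res'
      kept : ∀ y → ¬ InSep α β y → lookup γ y ≢ s1 →
             lookup (restrict δ) y ≡ lookup γ y × lookup (restrict δ) y ≡ lookup γ' y
      kept y ¬sep γ≢1 = δ≡γ , trans δ≡γ γ≡γ'
        where
        y∈W = restricts-∈W res γ≢1
        γ≡γ' : lookup γ y ≡ lookup γ' y
        γ≡γ' = trans (RI.product-value covγ isP γ≢1)
          (trans (comb-comm (lookup α y) _ ¬sep)
            (sym (RI.product-value covγ' isP' (γ≢1 ∘ RI.same-1 covγ' covγ))))
        δ≡γ : lookup (restrict δ) y ≡ lookup γ y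
        δ≡γ = trans (RestrictsTo.on (restricts δ) y∈W)
          (trans (keep y∈W (trans (sym (on y∈W)) (trans γ≡γ' (on' y∈W))) (γ≢1 ∘ trans (on y∈W)))
            (sym (on y∈W)))

    restriction-isOIG : IsOrientedIntervalGreedoid W FW LW
    restriction-isOIG = record
      { isIntervalGreedoid = restriction-isIG
      ; axioms = record
        { covectors = λ δ Lδ → let σ , Z , _ , covσ , Z⊆W , res = lift {δ} Lδ in
                        Z , RI.isCovectorAt (restriction-covector covσ Z⊆W res)
        ; OG1 = restriction-OG1
        ; OG2 = restriction-OG2
        ; OG3 = λ α β A B Z γ Lα Lβ covα covβ join isP →
            let τ , Lτ , covτ , Z⊆W , res =
                  restriction-product {A} {B} {Z} {α} {β} {γ} Lα Lβ
                    (RI.covector covα) (RI.covector covβ) join (RI.product isP) in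
            descend Lτ covτ Z⊆W res
        ; OG4 = λ α β A B Z γ γ' x Lα Lβ covα covβ join isP isP' →
            restriction-OG4 {α} {β} {A} {B} {Z} {γ} {γ'} {x} Lα Lβ
              (RI.covector covα) (RI.covector covβ) join (RI.product isP) (RI.product isP')
        }
      }

mainTheorem12 : ∀ {n} (G : Subset n) (F : Family n) (L : SVec n → Set) →
    IsOrientedIntervalGreedoid G F L →
    ∀ X → F X →
    ∀ (W : Subset n) → (∀ e → e ∈ W ⇔ Greedoid.ξ G F X e) →
    IsOrientedIntervalGreedoid W (restrictF W F) (restrictL G F L W)
mainTheorem12 G F L isOIG X FX W W⇔ξ = restriction-isOIG
  where open OrientedIntervalGreedoid.Restriction isOIG FX W⇔ξ
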